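{- Let $G$ be a ribbon graph, and let $\rho\in\{\delta\tau,\tau\delta,\tau,\delta\tau\delta\}$. Then there exists a subset $A\subseteq E(G)$, together with an ordering $e_1,\ldots,e_k$ of the elements of $A$, such that $$\varepsilon(G^{\rho|A})=\varepsilon_M^{\rho}(G),\qquad\text{where } \varepsilon_M^{\rho}(G)=\max_{B\subseteq E(G)}\varepsilon(G^{\rho|B}),$$ and the sequence $$\varepsilon(G),\ \varepsilon(G^{\rho|\{e_1\}}),\ \varepsilon(G^{\rho|\{e_1,e_2\}}),\ \ldots,\ \varepsilon(G^{\rho|A})$$ is non-decreasing.
   Context: A (finite) ribbon graph $G$ with vertex set $V(G)$ and edge set $E(G)$ is a compact surface with boundary, possibly non-orientable, presented as the union of a set $V(G)$ of discs (vertices) and a set $E(G)$ of discs (edges), such that vertices and edges intersect in disjoint line segments, each such segment lies on the boundary of precisely one vertex and precisely one edge, and every edge contains exactly two such segments. If $G$ has $v$ vertices, $e$ edges, $f$ boundary components and $k$ connected components, its Euler genus is $\varepsilon(G)=2k-v+e-f$. Partial dual $G^{\delta|A}$, $A\subseteq E(G)$: take the boundary components of the spanning ribbon subgraph $(V(G),A)$ as curves on the surface of $G$, glue a disc to $G$ along each of these curves, and remove the interiors of all vertices of $G$; the glued discs are the vertices of $G^{\delta|A}$, and its edge set is identified with $E(G)$. Partial Petrial $G^{\tau|A}$: for each edge in $A$, detach one end of the edge from its incident vertex, give the edge a half-twist, and reattach it. Words are read left to right: $G^{\delta\tau|A}=(G^{\delta|A})^{\tau|A}$, $G^{\tau\delta|A}=(G^{\tau|A})^{\delta|A}$,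 $G^{\delta\tau\delta|A}=((G^{\delta|A})^{\tau|A})^{\delta|A}$. -}

module Defs where

open import Data.Bool.Base using (Bool; true; false; not; if_then_else_; _xor_)
import Data.Bool.Properties as Bool
open import Data.Fin.Base using (Fin)
import Data.Fin.Properties as Fin
open import Data.Fin.Subset using (Subset; inside; outside; ⊥; ⁅_⁆; ⋃)
open import Data.Integer.Base using (ℤ; +_; _-_) renaming (_+_ to _+ᶻ_; _*_ to _*ᶻ_)
import Data.Integer.Properties as ℤ
open import Data.List.Base
  using (List; []; _∷_; _++_; map; length; foldl; allFin; cartesianProduct;
         cartesianProductWith; deduplicate)
open import Data.List.Extrema ℤ.≤-totalOrder using (max)
open import Data.List.Membership.Propositional using (_∈_; find; lose)
open import Data.List.Membership.Propositional.Properties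
  using (∈-allFin; ∈-cartesianProduct⁺; ∈-cartesianProductWith⁺; ∈-cartesianProductWith⁻)
open import Data.List.Relation.Unary.Any using (Any; here; there)
open import Data.Nat.Base using (ℕ; zero; suc; _+_)
open import Data.Product.Base using (_×_; _,_; swap)
open import Data.Product.Properties using (≡-dec)
open import Data.Vec.Base as Vec using (Vec; []; _∷_; lookup)
open import Data.Vec.Membership.Propositional using () renaming (_∈_ to _∈ᵛ_; find to findᵛ)
open import Data.Vec.Membership.Propositional.Properties
  using (∈-fromList⁺; ∈-fromList⁻) renaming (∈-map⁺ to ∈ᵛ-map⁺)
open import Data.Vec.Relation.Unary.Any using (here; there)
open import Data.Vec.Relation.Unary.Any.Properties using (map⁻)
open import Relation.Binary.Construct.Closure.Equivalence as Eq using (EqClosure)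
open import Relation.Binary.Definitions using (Decidable; DecidableEquality)
open import Relation.Binary.PropositionalEquality
  using (_≡_; _≢_; refl; sym; trans; cong; subst; isEquivalence)
open import Relation.Nullary.Decidable using (does; yes; no; map′)
open import Relation.Nullary.Negation using (contradiction)

------------------------------------------------------------------------
-- An edge disc is a rectangle.  Two opposite sides of it, numbered by the
-- first Bool, are the segments (the ends of the edge) along which it meets
-- vertices; the second Bool says on which of the two remaining, free sides
-- of the rectangle the corner lies.

Corner : ℕ → Set
Corner e = Fin e × Bool × Bool

-- The other corner on the same end, and the other corner on the same free
-- side, of the edge.
end side : ∀ {e} → Corner e → Corner e
end  (i , a , b) = i , a , not b
side (i , a , b) = i , not a , b

-- A ribbon graph with edge set Fin e.  Outside the ends of the edges, the
-- boundary of a vertex disc meeting at least one edge consists of arcs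
-- joining corners; every corner is an endpoint of exactly one of these arcs,
-- and `arc` sends it to the other endpoint.  Thus going round a vertex is
-- applying `arc` and `end` alternately, and the surface is recovered by
-- gluing a disc (the vertex) to each closed curve so obtained.  Vertices
-- meeting no edge have no corners and are only counted.  As `arc` is an
-- arbitrary fixed-point-free involution, non-orientable surfaces are
-- included.

record RibbonGraph (e : ℕ) : Set where
  field
    isolated       : ℕ
    arc            : Corner e → Corner e
    arc-involutive : ∀ c → arc (arc c) ≡ c
    arc-no-fixed   : ∀ c → arc c ≢ c

open RibbonGraph public

------------------------------------------------------------------------
-- Counting orbits of corners

SameOrbit : ∀ {e} → List (Corner e → Corner e) → Corner e → Corner e → Set
SameOrbit fs = EqClosure (λ c d → Any (λ f → f c ≡ d) fs)

corners : ∀ e → List (Corner e)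
corners e = cartesianProduct (allFin e) (cartesianProduct bools bools)
  where bools = true ∷ false ∷ []

∈-corners : ∀ {e} (c : Corner e) → c ∈ corners e
∈-corners (i , a , b) =
  ∈-cartesianProduct⁺ (∈-allFin i) (∈-cartesianProduct⁺ (∈-bools a) (∈-bools b))
  where
  ∈-bools : ∀ x → x ∈ true ∷ false ∷ []
  ∈-bools true  = here refl
  ∈-bools false = there (here refl)

_≟ᶜ_ : ∀ {e} → DecidableEquality (Corner e)
_≟ᶜ_ = ≡-dec Fin._≟_ (≡-dec Bool._≟_ Bool._≟_)

-- The equivalence closure of a finite list of pairs is decided by
-- contracting the pairs one after the other.
module _ {X : Set} (_≟_ : DecidableEquality X) where

  Generated : ∀ {n} → Vec (X × X) n → X → X → Set
  Generated ps = EqClosure (λ x y → (x , y) ∈ᵛ ps)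

  replace : X → X → X → X
  replace p q x = if does (x ≟ p) then q else x

  replace₂ : X → X → X × X → X × X
  replace₂ p q (x , y) = replace p q x , replace p q y

  generated? : ∀ {n} (ps : Vec (X × X) n) → Decidable (Generated ps)
  generated? [] x y =
    map′ (λ { refl → Eq.reflexive _ }) (Eq.fold isEquivalence (λ ())) (x ≟ y)
  generated? ((p , q) ∷ ps) x y =
    map′ (λ r → ≈trans (≈s x) (≈trans (Eq.fold (Eq.isEquivalence _) expand r) (≈sym (≈s y))))
         (Eq.gfold (Eq.isEquivalence _) s contract)
         (generated? (Vec.map s₂ ps) (s x) (s y))
    where
    s  = replace p q
    s₂ = replace₂ p q

    _~_ = Generated (Vec.map s₂ ps)
    _≈_ = Generated ((p , q) ∷ ps)

    ≈sym : ∀ {x y} → x ≈ y → y ≈ x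
    ≈sym = Eq.symmetric _

    ≈trans : ∀ {x y z} → x ≈ y → y ≈ z → x ≈ z
    ≈trans = Eq.transitive _

    ≈s : ∀ x → x ≈ s x
    ≈s x with x ≟ p
    ... | yes refl = Eq.return (here refl)
    ... | no _     = Eq.reflexive _

    sp≡sq : s p ≡ s q
    sp≡sq with p ≟ p | q ≟ p
    ... | yes _  | yes _ = refl
    ... | yes _  | no _  = refl
    ... | no p≢p | _     = contradiction refl p≢p

    expand : ∀ {x y} → (x , y) ∈ᵛ Vec.map s₂ ps → x ≈ y
    expand xy∈ with _ , uv∈ , refl ← findᵛ (map⁻ xy∈)
      = ≈trans (≈sym (≈s _)) (≈trans (Eq.return (there uv∈)) (≈s _))

    contract : ∀ {x y} → (x , y) ∈ᵛ (p , q) ∷ ps → s x ~ s y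
    contract (here refl) = subst (s p ~_) sp≡sq (Eq.reflexive _)
    contract (there xy∈) = Eq.return (∈ᵛ-map⁺ s₂ xy∈)

sameOrbit? : ∀ {e} (fs : List (Corner e → Corner e)) → Decidable (SameOrbit fs)
sameOrbit? {e} fs c d =
  map′ (Eq.map to) (Eq.map from) (generated? _≟ᶜ_ (Vec.fromList steps) c d)
  where
  graph : (Corner e → Corner e) → Corner e → Corner e × Corner e
  graph f x = x , f x

  steps : List (Corner e × Corner e)
  steps = cartesianProductWith graph fs (corners e)

  to : ∀ {x y} → (x , y) ∈ᵛ Vec.fromList steps → Any (λ f → f x ≡ y) fs
  to xy∈ with _ , _ , f∈fs , _ , refl ← ∈-cartesianProductWith⁻ graph fs (corners e) (∈-fromList⁻ xy∈)
    = lose f∈fs refl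

  from : ∀ {x y} → Any (λ f → f x ≡ y) fs → (x , y) ∈ᵛ Vec.fromList steps
  from {x} fx≡y with _ , f∈fs , refl ← find fx≡y
    = ∈-fromList⁺ (∈-cartesianProductWith⁺ graph f∈fs (∈-corners x))

orbits : ∀ {e} → List (Corner e → Corner e) → ℕ
orbits {e} fs = length (deduplicate (sameOrbit? fs) (corners e))

------------------------------------------------------------------------
-- Euler genus.  An isolated vertex is one vertex, has one boundary
-- component and is one connected component.

module _ {e} (G : RibbonGraph e) where

  vertices boundaryComponents components : ℕ
  vertices           = isolated G + orbits (arc G ∷ end ∷ [])
  boundaryComponents = isolated G + orbits (arc G ∷ side ∷ [])
  components         = isolated G + orbits (arc G ∷ end ∷ side ∷ [])

  ε : ℤ
  ε = + 2 *ᶻ + components - + vertices +ᶻ + e - + boundaryComponents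

------------------------------------------------------------------------
-- Partial duals and partial Petrials

onEdges : ∀ {e} → Subset e → (Bool × Bool → Bool × Bool) → Corner e → Corner e
onEdges A h (i , x) = i , (if lookup A i then h x else x)

onEdges-involutive : ∀ {e} (A : Subset e) {h} → (∀ x → h (h x) ≡ x) →
                     ∀ c → onEdges A h (onEdges A h c) ≡ c
onEdges-involutive A hh (i , x) with lookup A i
... | true  = cong (i ,_) (hh x)
... | false = refl

-- In the new ribbon graph, the corner c is the one called r c in G.
relabel : ∀ {e} (r : Corner e → Corner e) → (∀ c → r (r c) ≡ c) →
          RibbonGraph e → RibbonGraph e
relabel r rr G = record
  { isolated       = isolated G
  ; arc            = λ c → r (arc G (r c))
  ; arc-involutive = λ c →
      trans (cong (λ d → r (arc G d)) (rr (arc G (r c))))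
            (trans (cong r (arc-involutive G (r c))) (rr c))
  ; arc-no-fixed   = λ c eq →
      arc-no-fixed G (r c) (trans (sym (rr (arc G (r c)))) (cong r eq))
  }

-- A boundary component of (V(G), A) runs along the arcs of vertices, along
-- the free sides of the edges in A, and along the segments where the edges
-- outside A are attached.  These curves bound the vertices of the partial
-- dual, so the edges in A are now attached along their former free sides,
-- and their former ends are free; see `boundary-becomes-vertex`.
partialDual : ∀ {e} → RibbonGraph e → Subset e → RibbonGraph e
partialDual G A = relabel (onEdges A swap) (onEdges-involutive A (λ _ → refl)) G

alongBoundary : ∀ {e} → Subset e → Corner e → Corner e
alongBoundary A c@(i , _) = if lookup A i then side c else end c

boundary-becomes-vertex : ∀ {e} (A : Subset e) (c : Corner e) →
  onEdges A swap (alongBoundary A c) ≡ end (onEdges A swap c)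
boundary-becomes-vertex A (i , a , b) with lookup A i in eq
... | true  rewrite eq = refl
... | false rewrite eq = refl

-- The end numbered `true` is detached and reattached after a half-twist,
-- which exchanges the places of its two corners.
halfTwist : Bool × Bool → Bool × Bool
halfTwist (a , b) = a , a xor b

halfTwist-involutive : ∀ x → halfTwist (halfTwist x) ≡ x
halfTwist-involutive (true  , b) = cong (true ,_) (Bool.not-involutive b)
halfTwist-involutive (false , b) = refl

partialPetrial : ∀ {e} → RibbonGraph e → Subset e → RibbonGraph e
partialPetrial G A =
  relabel (onEdges A halfTwist) (onEdges-involutive A halfTwist-involutive) G

data Letter : Set where
  δ τ : Letter

Word : Set
Word = List Letter

apply : ∀ {e} → Subset e → RibbonGraph e → Letter → RibbonGraph e
apply A G δ = partialDual G A
apply A G τ = partialPetrial G A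

infixl 8 _^[_∣_]

_^[_∣_] : ∀ {e} → RibbonGraph e → Word → Subset e → RibbonGraph e
G ^[ w ∣ A ] = foldl (apply A) G w

------------------------------------------------------------------------
-- Maximum over all subsets of the edge set

subsets : ∀ e → List (Subset e)
subsets zero    = [] ∷ []
subsets (suc e) = map (inside ∷_) (subsets e) ++ map (outside ∷_) (subsets e)

-- `max` takes a default value besides the list; the value at B = ∅ serves.
εᴹ : ∀ {e} → Word → RibbonGraph e → ℤ
εᴹ {e} w G = max (ε (G ^[ w ∣ ⊥ ])) (map (λ B → ε (G ^[ w ∣ B ])) (subsets e))

fromList : ∀ {e} → List (Fin e) → Subset e
fromList es = ⋃ (map ⁅_⁆ es)

{-# OPTIONS --safe #-}

-- On each edge the word ρ acts by a linear automorphism of the four corners Bool × Bool, and `end`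
-- and `side` are translations there.  Pulled back to the corners of G, the vertices and the boundary
-- components of G^{ρ|S} are therefore the closed curves formed by the arcs of G and, on each edge, a
-- translation depending only on whether the edge is in S; so ε is a constant minus the numbers v(S)
-- and f(S) of curves of two such systems.  Changing the translation at one edge raises the number of
-- curves by at most one, and lowers it if the corners of that edge lie on two curves that get joined.
-- If no edge of A \ S joins two curves of S, every curve of A lies in a curve of S, hence
-- v(S) ≤ v(A).  So, fixing a maximiser A and starting from S = ∅: if v(A) < v(S) or f(A) < f(S),
-- some edge of A \ S can be added to S without raising v + f; otherwise S is itself a maximiser.
module Submission where

open import Defs
open import Algebra.Properties.CommutativeSemigroup using (interchange)
open import Data.Bool.Base using (Bool; true; false; if_then_else_; _xor_)
import Data.Bool.Properties as Bool
open import Data.Fin.Base using (Fin)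
import Data.Fin.Properties as Fin
open import Data.Fin.Subset using (Subset; ⊥; ⁅_⁆; _∪_; _⊆_; _⊃_) renaming (_∈_ to _∈ˢ_; _∉_ to _∉ˢ_)
open import Data.Fin.Subset.Induction using (⊃-wellFounded)
open import Data.Fin.Subset.Properties
  using (_∈?_; x∈⁅x⁆; x∈⁅y⁆⇒x≡y; x∈p∪q⁺; x∈p∪q⁻; p⊆p∪q; ∪-identityˡ; ∪-identityʳ; ∪-assoc; ⊆-min; ∉⊥)
open import Data.Integer.Base using (ℤ; _≤_; +_; +≤+; _-_) renaming (_+_ to _+ᶻ_; _*_ to _*ᶻ_)
import Data.Integer.Properties as ℤ
open import Data.Integer.Solver using (module +-*-Solver)
open import Data.List.Base
  using (List; []; _∷_; _++_; map; drop; inits; length; lookup; filter; deduplicate)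
open import Data.List.Extrema ℤ.≤-totalOrder using (xs≤max; argmax-sel)
open import Data.List.Membership.Propositional using (_∈_; find; lose)
open import Data.List.Membership.Propositional.Properties
  using (∈-lookup; ∈-∃++; ∈-map⁺; ∈-map⁻; ∈-++⁺ˡ; ∈-++⁺ʳ; ∈-filter⁺; ∈-filter⁻)
open import Data.List.Properties using (map-cong; map-∘; length-map)
open import Data.List.Relation.Binary.Permutation.Propositional using (↭-sym; ↭⇒↭ₛ)
open import Data.List.Relation.Binary.Permutation.Propositional.Properties
  using (shift; ∈-resp-↭; ↭-length)
import Data.List.Relation.Binary.Permutation.Setoid.Properties as Permₛ
open import Data.List.Relation.Unary.All as All using (All; []; _∷_)
open import Data.List.Relation.Unary.All.Properties using (¬Any⇒All¬)
open import Data.List.Relation.Unary.AllPairs as AllPairs using (AllPairs; []; _∷_)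
import Data.List.Relation.Unary.AllPairs.Properties as AllPairs
open import Data.List.Relation.Unary.Any as Any using (Any; here; there)
import Data.List.Relation.Unary.Any.Properties as Any
open import Data.List.Relation.Unary.Linked as Linked using (Linked; [-]; _∷_)
import Data.List.Relation.Unary.Linked.Properties as Linked
open import Data.List.Relation.Unary.Unique.Propositional using (Unique)
import Data.List.Relation.Unary.Unique.Propositional.Properties as Unique
import Data.List.Relation.Unary.Unique.DecSetoid.Properties as UniqueDec
import Data.Nat.Base as ℕ
open import Data.Nat.Base using (ℕ; suc; _+_)
open import Data.Nat.Divisibility using (_∣_; ∣m∣n⇒∣m+n; ∣m+n∣m⇒∣n; ∣-refl; _∣0; ∣1⇒≡1)
open import Data.Nat.Induction using (<-wellFounded)
import Data.Nat.Properties as ℕ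
open import Data.Product.Base as Product using (Σ; ∃; _×_; _,_; proj₁; proj₂; swap)
open import Data.Product.Properties using (≡-dec)
open import Data.Sum.Base as Sum using (_⊎_; inj₁; inj₂; [_,_]′)
open import Data.Vec.Base using ([]; _∷_) renaming (lookup to lookupᵛ)
open import Data.Vec.Properties using ([]=⇒lookup; lookup⇒[]=)
open import Function.Base using (id; _∘_)
open import Induction.WellFounded using (Acc; acc)
open import Level using (0ℓ)
open import Relation.Binary.Bundles using (DecSetoid)
import Relation.Binary.Construct.Closure.Equivalence as Eq
open import Relation.Binary.Core using (Rel; _⇒_)
open import Relation.Binary.Definitions using (DecidableEquality)
open import Relation.Binary.PropositionalEquality
  using (_≡_; _≢_; refl; sym; trans; cong; cong₂; subst; subst₂; setoid)
open import Relation.Binary.Structures using (IsEquivalence)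
open import Relation.Nullary.Decidable
  using (Dec; yes; no; ¬?; _×-dec_; _⊎-dec_; _→-dec_; map′; from-yes; toSum)
open import Relation.Nullary.Negation using (¬_; contradiction)
import Relation.Unary as U

-- Counting classes of an equivalence relation

module _ {X : Set} {_~_ : Rel X 0ℓ} (~-isEquivalence : IsEquivalence _~_) where

  private module ~ = IsEquivalence ~-isEquivalence

  lookup-inequivalent : ∀ {xs} → AllPairs (λ x y → ¬ x ~ y) xs →
                        ∀ i j → lookup xs i ~ lookup xs j → i ≡ j
  lookup-inequivalent (px ∷ pxs) Fin.zero    Fin.zero    r = refl
  lookup-inequivalent (px ∷ pxs) Fin.zero    (Fin.suc j) r =
    contradiction r (All.lookup px (∈-lookup j))
  lookup-inequivalent (px ∷ pxs) (Fin.suc i) Fin.zero    r =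
    contradiction (~.sym r) (All.lookup px (∈-lookup i))
  lookup-inequivalent (px ∷ pxs) (Fin.suc i) (Fin.suc j) r =
    cong Fin.suc (lookup-inequivalent pxs i j r)

  inequivalent-∈ : ∀ {xs x y} → AllPairs (λ x y → ¬ x ~ y) xs → x ∈ xs → y ∈ xs → x ~ y → x ≡ y
  inequivalent-∈ _         (here refl) (here refl) r = refl
  inequivalent-∈ (px ∷ _)  (here refl) (there y∈)  r = contradiction r (All.lookup px y∈)
  inequivalent-∈ (px ∷ _)  (there x∈)  (here refl) r = contradiction (~.sym r) (All.lookup px x∈)
  inequivalent-∈ (_ ∷ pxs) (there x∈)  (there y∈)  r = inequivalent-∈ pxs x∈ y∈ r

  -- Pigeonhole: two members of `xs` sent to the same position of `ys` would be equivalent to each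
  -- other.
  inequivalent-≤-cover : ∀ {xs ys} → AllPairs (λ x y → ¬ x ~ y) xs →
                         (∀ x → Any (x ~_) ys) → length xs ℕ.≤ length ys
  inequivalent-≤-cover {xs} {ys} xs-ineq cover = Fin.injective⇒≤ {f = index} λ {i} {j} eq →
    lookup-inequivalent xs-ineq i j
      (~.trans (near i) (~.sym (subst (λ k → lookup xs j ~ lookup ys k) (sym eq) (near j))))
    where
    index : Fin (length xs) → Fin (length ys)
    index i = Any.index (cover (lookup xs i))

    near : ∀ i → lookup xs i ~ lookup ys (index i)
    near i = Any.lookup-index (cover (lookup xs i))

module _ {e : ℕ} (fs : List (Corner e → Corner e)) where

  orbitEquivalence : IsEquivalence (SameOrbit fs)
  orbitEquivalence = Eq.isEquivalence _

  private
    decSetoid : DecSetoid 0ℓ 0ℓ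
    decSetoid = record
      { isDecEquivalence = record
        { isEquivalence = orbitEquivalence
        ; _≟_           = sameOrbit? fs
        }
      }

  representatives : List (Corner e)
  representatives = deduplicate (sameOrbit? fs) (corners e)

  representatives-inequivalent : AllPairs (λ c d → ¬ SameOrbit fs c d) representatives
  representatives-inequivalent = UniqueDec.deduplicate-! decSetoid (corners e)

  represented : ∀ c → Any (SameOrbit fs c) representatives
  represented c = Any.deduplicate⁺ (sameOrbit? fs) (λ r s → O.trans s (O.sym r))
                    (Any.map (λ { refl → O.refl }) (∈-corners c))
    where module O = IsEquivalence orbitEquivalence

  -- `representatives` is both inequivalent and covering, so inequivalent lists bound `orbits` from
  -- below and covering lists bound it from above.
  inequivalent-≤-orbits : ∀ {cs} → AllPairs (λ c d → ¬ SameOrbit fs c d) cs →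
                          length cs ℕ.≤ orbits fs
  inequivalent-≤-orbits ineq = inequivalent-≤-cover orbitEquivalence ineq represented

  orbits-≤-cover : ∀ {cs} → (∀ c → Any (SameOrbit fs c) cs) → orbits fs ℕ.≤ length cs
  orbits-≤-cover = inequivalent-≤-cover orbitEquivalence representatives-inequivalent

module _ {e : ℕ} {fs gs : List (Corner e → Corner e)} where

  private
    module F = IsEquivalence (orbitEquivalence fs)
    module G = IsEquivalence (orbitEquivalence gs)

  orbits-reindex : (φ : Corner e → Corner e) →
                   (∀ {c d} → SameOrbit fs (φ c) (φ d) → SameOrbit gs c d) →
                   orbits gs ℕ.≤ orbits fs
  orbits-reindex φ reflects =
    subst (ℕ._≤ orbits fs) (length-map φ (representatives gs))
      (inequivalent-≤-orbits fs
        (AllPairs.map⁺ (AllPairs.map (λ ¬g f → ¬g (reflects f)) (representatives-inequivalent gs))))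

  orbits-antitone : SameOrbit fs ⇒ SameOrbit gs → orbits gs ℕ.≤ orbits fs
  orbits-antitone = orbits-reindex id

  -- If `c` and `d` were both `fs`-equivalent to representatives of `gs`, these would coincide and
  -- force `c` and `d` together. So one of the two can be added to the representatives as a further
  -- `fs`-class.
  orbits-strictly-antitone : SameOrbit fs ⇒ SameOrbit gs → ∀ {c d} →
                             SameOrbit gs c d → ¬ SameOrbit fs c d →
                             orbits gs ℕ.< orbits fs
  orbits-strictly-antitone f⇒g {c} {d} c~d c≁d = split (missing c) (missing d)
    where
    missing : ∀ x → Any (SameOrbit fs x) (representatives gs) ⊎ orbits gs ℕ.< orbits fs
    missing x = Sum.map₂ (λ ¬x → inequivalent-≤-orbits fs
        (¬Any⇒All¬ _ ¬x ∷ AllPairs.map (_∘ f⇒g) (representatives-inequivalent gs)))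
      (toSum (Any.any? (sameOrbit? fs x) (representatives gs)))

    split : Any (SameOrbit fs c) (representatives gs) ⊎ orbits gs ℕ.< orbits fs →
            Any (SameOrbit fs d) (representatives gs) ⊎ orbits gs ℕ.< orbits fs →
            orbits gs ℕ.< orbits fs
    split (inj₂ less) _           = less
    split (inj₁ _)    (inj₂ less) = less
    split (inj₁ ∃r)   (inj₁ ∃s)
      with r , r∈ , c~r ← find ∃r | s , s∈ , d~s ← find ∃s
      with refl ← inequivalent-∈ (orbitEquivalence gs) (representatives-inequivalent gs) r∈ s∈
                    (G.trans (G.sym (f⇒g c~r)) (G.trans c~d (f⇒g d~s)))
      = contradiction (F.trans c~r (F.sym d~s)) c≁d

  -- Outside the orbits of `a` and `b`, a `gs`-step never leaves its `fs`-orbit. The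
  -- `gs`-representative of `a` lies in one of these two orbits, so adding the other point to the
  -- representatives meets every `fs`-orbit.
  orbits-merge-two : ∀ a b →
    (let Merged = λ c → SameOrbit fs c a ⊎ SameOrbit fs c b) →
    (∀ {c d} → Any (λ g → g c ≡ d) gs → SameOrbit fs c d ⊎ Merged c × Merged d) →
    orbits fs ℕ.≤ suc (orbits gs)
  orbits-merge-two a b steps
    with r , r∈ , a~r ← find (represented gs a)
    = [ (λ r~a → orbits-≤-cover fs {b ∷ representatives gs} λ c →
          [ there , [ (λ c~a → there (lose r∈ (F.trans c~a (F.sym r~a)))) , here ]′ ]′ (located c))
      , (λ r~b → orbits-≤-cover fs {a ∷ representatives gs} λ c →
          [ there , [ here , (λ c~b → there (lose r∈ (F.trans c~b (F.sym r~b)))) ]′ ]′ (located c))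
      ]′ ([ (λ a~r → inj₁ (F.sym a~r)) , proj₂ ]′ (g⇒f a~r))
    where
    Merged : Corner e → Set
    Merged c = SameOrbit fs c a ⊎ SameOrbit fs c b

    Merged-resp : ∀ {c d} → SameOrbit fs c d → Merged d → Merged c
    Merged-resp c~d = Sum.map (F.trans c~d) (F.trans c~d)

    ≈-isEquivalence : IsEquivalence (λ c d → SameOrbit fs c d ⊎ Merged c × Merged d)
    ≈-isEquivalence = record
      { refl  = inj₁ F.refl
      ; sym   = Sum.map F.sym swap
      ; trans = λ where
          (inj₁ p)       (inj₁ q)       → inj₁ (F.trans p q)
          (inj₁ p)       (inj₂ (m , n)) → inj₂ (Merged-resp p m , n)
          (inj₂ (m , n)) (inj₁ q)       → inj₂ (m , Merged-resp (F.sym q) n)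
          (inj₂ (m , _)) (inj₂ (_ , n)) → inj₂ (m , n)
      }

    g⇒f : ∀ {c d} → SameOrbit gs c d → SameOrbit fs c d ⊎ Merged c × Merged d
    g⇒f = Eq.fold ≈-isEquivalence steps

    located : ∀ c → Any (SameOrbit fs c) (representatives gs) ⊎ Merged c
    located c with r , r∈ , c~r ← find (represented gs c) =
      Sum.map (lose r∈) proj₁ (g⇒f c~r)

-- Every step of `fs` is carried by `φ` into one orbit of `gs`, so the section `ψ` sends distinct
-- orbits of `gs` to distinct orbits of `fs`.
orbits-≤-image : ∀ {e} {fs gs : List (Corner e → Corner e)} (φ ψ : Corner e → Corner e) →
                 (∀ c → φ (ψ c) ≡ c) →
                 (∀ {c d} → Any (λ f → f c ≡ d) fs → SameOrbit gs (φ c) (φ d)) →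
                 orbits gs ℕ.≤ orbits fs
orbits-≤-image {gs = gs} φ ψ φψ steps = orbits-reindex ψ λ {c} {d} r →
  subst₂ (SameOrbit gs) (φψ c) (φψ d) (Eq.gfold (orbitEquivalence gs) φ steps r)

-- Fixed-point-free involutions

module _ {X : Set} {f : X → X} (f-involutive : ∀ x → f (f x) ≡ x) (f-no-fixed : ∀ x → f x ≢ x) where

  -- Remove `x` and `f x` together: no other element is sent to either of them, so the rest is still
  -- closed, and shorter by two.
  closed⇒even : ∀ {xs} → Unique xs → (∀ {x} → x ∈ xs → f x ∈ xs) → 2 ∣ length xs
  closed⇒even {xs} = go xs (<-wellFounded (length xs))
    where
    go : ∀ xs → Acc ℕ._<_ (length xs) → Unique xs → (∀ {x} → x ∈ xs → f x ∈ xs) → 2 ∣ length xs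
    go [] _ _ _ = 2 ∣0
    go (x ∷ ys) (acc rec) (x∉ys ∷ ys-unique) closed
      with closed (here refl)
    ... | here fx≡x = contradiction fx≡x (f-no-fixed x)
    ... | there fx∈ys
      with as , bs , refl ← ∈-∃++ fx∈ys
      = subst (2 ∣_) (cong suc (sym (↭-length ↭))) (∣m∣n⇒∣m+n ∣-refl
          (go zs (rec (ℕ.m≤n⇒m≤1+n (ℕ.≤-reflexive (sym (↭-length ↭))))) zs-unique zs-closed))
      where
      zs = as ++ bs
      ↭  = shift (f x) as bs

      fx∷zs-unique : Unique (f x ∷ zs)
      fx∷zs-unique = Permₛ.Unique-resp-↭ (setoid X) (↭⇒↭ₛ ↭) ys-unique

      zs-unique : Unique zs
      zs-unique = AllPairs.tail fx∷zs-unique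

      zs-closed : ∀ {z} → z ∈ zs → f z ∈ zs
      zs-closed {z} z∈zs with closed (there (∈-resp-↭ (↭-sym ↭) (there z∈zs)))
      ... | here fz≡x = contradiction (trans (cong f (sym fz≡x)) (f-involutive z))
                          (All.lookup (AllPairs.head fx∷zs-unique) z∈zs)
      ... | there fz∈ys with ∈-resp-↭ ↭ fz∈ys
      ... | there fz∈zs = fz∈zs
      ... | here fz≡fx  = contradiction
              (trans (sym (f-involutive x)) (trans (cong f (sym fz≡fx)) (f-involutive z)))
              (All.lookup x∉ys (∈-resp-↭ (↭-sym ↭) (there z∈zs)))

-- The Klein four-group

Klein : Set
Klein = Bool × Bool

infixr 6 _⊕_

_⊕_ : Klein → Klein → Klein
(a , b) ⊕ (c , d) = a xor c , b xor d

𝟘 : Klein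
𝟘 = false , false

_≟ᴷ_ : DecidableEquality Klein
_≟ᴷ_ = ≡-dec Bool._≟_ Bool._≟_

∀Bool? : {P : Bool → Set} → U.Decidable P → Dec (∀ b → P b)
∀Bool? P? = map′ (λ { (t , f) true → t ; (t , f) false → f }) (λ p → p true , p false)
                 (P? true ×-dec P? false)

∀Klein? : {P : Klein → Set} → U.Decidable P → Dec (∀ x → P x)
∀Klein? P? = map′ (λ p (a , b) → p a b) (λ p a b → p (a , b))
                  (∀Bool? λ a → ∀Bool? λ b → P? (a , b))

-- A with-abstraction over ⊕-exhaustive would otherwise normalise the decision procedure.
abstract

  ⊕-involutive : ∀ p x → p ⊕ p ⊕ x ≡ x
  ⊕-involutive = from-yes (∀Klein? λ p → ∀Klein? λ x → (p ⊕ p ⊕ x) ≟ᴷ x)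

  ⊕-swap : ∀ p q x → p ⊕ q ⊕ x ≡ q ⊕ p ⊕ x
  ⊕-swap = from-yes (∀Klein? λ p → ∀Klein? λ q → ∀Klein? λ x → (p ⊕ q ⊕ x) ≟ᴷ (q ⊕ p ⊕ x))

  ⊕-no-fixed : ∀ p x → p ≢ 𝟘 → p ⊕ x ≢ x
  ⊕-no-fixed = from-yes (∀Klein? λ p → ∀Klein? λ x → ¬? (p ≟ᴷ 𝟘) →-dec ¬? ((p ⊕ x) ≟ᴷ x))

  -- Two distinct nonzero elements generate the four-group, hence reach every corner of an edge from
  -- any one of them.
  ⊕-exhaustive : ∀ p q x y → p ≢ 𝟘 → q ≢ 𝟘 → p ≢ q →
                 y ≡ x ⊎ y ≡ q ⊕ x ⊎ y ≡ p ⊕ x ⊎ y ≡ q ⊕ p ⊕ x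
  ⊕-exhaustive = from-yes (∀Klein? λ p → ∀Klein? λ q → ∀Klein? λ x → ∀Klein? λ y →
    ¬? (p ≟ᴷ 𝟘) →-dec ¬? (q ≟ᴷ 𝟘) →-dec ¬? (p ≟ᴷ q) →-dec
    ((y ≟ᴷ x) ⊎-dec (y ≟ᴷ (q ⊕ x)) ⊎-dec (y ≟ᴷ (p ⊕ x)) ⊎-dec (y ≟ᴷ (q ⊕ p ⊕ x))))

-- Curves through the corners

-- The constant direction `(false , true)` makes `translate` into `end`, and `(true , false)` makes
-- it into `side`.
Directions : ℕ → Set
Directions e = Fin e → Klein

translate : ∀ {e} → Directions e → Corner e → Corner e
translate d (i , x) = i , d i ⊕ x

translate-involutive : ∀ {e} (d : Directions e) c → translate d (translate d c) ≡ c
translate-involutive d (i , x) = cong (i ,_) (⊕-involutive (d i) x)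

Nonzero : ∀ {e} → Directions e → Set
Nonzero d = ∀ i → d i ≢ 𝟘

translate-no-fixed : ∀ {e} {d : Directions e} → Nonzero d → ∀ c → translate d c ≢ c
translate-no-fixed {d = d} d≢𝟘 (i , x) eq = ⊕-no-fixed (d i) x (d≢𝟘 i) (cong proj₂ eq)

corners-unique : ∀ e → Unique (corners e)
corners-unique e = Unique.cartesianProduct⁺ (Unique.allFin⁺ e)
  (Unique.cartesianProduct⁺ bools-unique bools-unique)
  where
  bools-unique : Unique (true ∷ false ∷ [])
  bools-unique = ((λ ()) ∷ []) ∷ [] ∷ []

module Curves {e} (a : Corner e → Corner e)
  (a-involutive : ∀ c → a (a c) ≡ c) (a-no-fixed : ∀ c → a c ≢ c) where

  -- A record, so that d can be inferred from d ⊢ c ~ c′.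
  record _⊢_~_ (d : Directions e) (c c′ : Corner e) : Set where
    constructor ⟨_⟩
    field sameOrbit : SameOrbit (a ∷ translate d ∷ []) c c′

  open _⊢_~_

  curves : Directions e → ℕ
  curves d = orbits (a ∷ translate d ∷ [])

  ~-isEquivalence : ∀ d → IsEquivalence (d ⊢_~_)
  ~-isEquivalence d = record
    { refl  = ⟨ O.refl ⟩
    ; sym   = λ { ⟨ r ⟩ → ⟨ O.sym r ⟩ }
    ; trans = λ { ⟨ r ⟩ ⟨ s ⟩ → ⟨ O.trans r s ⟩ }
    }
    where module O = IsEquivalence (orbitEquivalence (a ∷ translate d ∷ []))

  module _ {d : Directions e} where
    open IsEquivalence (~-isEquivalence d) public
      using () renaming (refl to ~refl; sym to ~sym; trans to ~trans)

    ~a : ∀ c → d ⊢ c ~ a c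
    ~a c = ⟨ Eq.return (here refl) ⟩

    ~translate : ∀ c → d ⊢ c ~ translate d c
    ~translate c = ⟨ Eq.return (there (here refl)) ⟩

    ~⊕ : ∀ {p} i x → d i ≡ p → d ⊢ (i , x) ~ (i , p ⊕ x)
    ~⊕ i x refl = ~translate (i , x)

  ⊢-mono : ∀ {d d′} → (∀ c → d′ ⊢ c ~ translate d c) →
           SameOrbit (a ∷ translate d ∷ []) ⇒ SameOrbit (a ∷ translate d′ ∷ [])
  ⊢-mono {d} {d′} steps r = sameOrbit (Eq.fold (~-isEquivalence d′) step r)
    where
    step : ∀ {c c′} → Any (λ f → f c ≡ c′) (a ∷ translate d ∷ []) → d′ ⊢ c ~ c′
    step (here refl)         = ~a _
    step (there (here refl)) = steps _

  decide : ∀ d c c′ → Dec (d ⊢ c ~ c′)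
  decide d c c′ = map′ ⟨_⟩ sameOrbit (sameOrbit? (a ∷ translate d ∷ []) c c′)

  ~-shift-self : ∀ {d i} q x → d ⊢ (i , x) ~ (i , q ⊕ x) → d ⊢ (i , q ⊕ x) ~ (i , q ⊕ q ⊕ x)
  ~-shift-self {d} {i} q x x~qx =
    subst (λ z → d ⊢ (i , q ⊕ x) ~ (i , z)) (sym (⊕-involutive q x)) (~sym x~qx)

  ~-shift-along : ∀ {d i} q x → d ⊢ (i , x) ~ (i , q ⊕ x) → d ⊢ (i , d i ⊕ x) ~ (i , q ⊕ d i ⊕ x)
  ~-shift-along {d} {i} q x x~qx = ~trans (~sym (~translate (i , x))) (~trans x~qx
    (subst (λ z → d ⊢ (i , q ⊕ x) ~ (i , z)) (⊕-swap (d i) q x) (~translate (i , q ⊕ x))))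

  -- When `d i` differs from `q`, translations by `d i` and `q` carry the relation at `x` to the
  -- whole edge. Testing one corner per edge is therefore enough.
  ~-shift : ∀ {d} → Nonzero d → ∀ {q i} → q ≢ 𝟘 → ∀ x y →
            d ⊢ (i , x) ~ (i , q ⊕ x) → d ⊢ (i , y) ~ (i , q ⊕ y)
  ~-shift {d} d≢𝟘 {q} {i} q≢𝟘 x y x~qx with d i ≟ᴷ q
  ... | yes p≡q = ~⊕ i y p≡q
  ... | no  p≢q with ⊕-exhaustive (d i) q x y (d≢𝟘 i) q≢𝟘 p≢q
  ... | inj₁ refl               = x~qx
  ... | inj₂ (inj₁ refl)        = ~-shift-self q x x~qx
  ... | inj₂ (inj₂ (inj₁ refl)) = ~-shift-along q x x~qx
  ... | inj₂ (inj₂ (inj₂ refl)) = ~-shift-self q (d i ⊕ x) (~-shift-along q x x~qx)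

  -- `joined` puts each step along `d′` inside a curve of `d`, so every curve of `d′` lies in a
  -- curve of `d`.
  curves-≤ : ∀ {d d′} → Nonzero d → Nonzero d′ →
             (∀ i → d ⊢ (i , 𝟘) ~ (i , d′ i ⊕ 𝟘)) → curves d ℕ.≤ curves d′
  curves-≤ {d} {d′} d≢𝟘 d′≢𝟘 joined = orbits-antitone
    (⊢-mono {d′} {d} λ (i , x) → ~-shift d≢𝟘 (d′≢𝟘 i) 𝟘 x (joined i))

  module Switch {d d′ : Directions e} (d≢𝟘 : Nonzero d) (d′≢𝟘 : Nonzero d′)
    {i : Fin e} (agree : ∀ j → j ≢ i → d j ≡ d′ j) where

    -- Where the directions at `i` differ, every corner of `i` is joined in `d′` to `𝟘` or to
    -- `d i ⊕ 𝟘`. Passing to `d` can thus merge at most the two curves of `d′` through these.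
    curves-≤-suc : curves d′ ℕ.≤ suc (curves d)
    curves-≤-suc = orbits-merge-two (i , 𝟘) (i , d i ⊕ 𝟘)
      λ { (here refl)         → inj₁ (sameOrbit {d = d′} (~a _))
        ; (there (here refl)) →
            Sum.map sameOrbit (λ (m , n) → Sum.map sameOrbit sameOrbit m , Sum.map sameOrbit sameOrbit n)
                    (step _ _)
        }
      where
      Merged : Corner e → Set
      Merged c = d′ ⊢ c ~ (i , 𝟘) ⊎ d′ ⊢ c ~ (i , d i ⊕ 𝟘)

      step : ∀ j x → d′ ⊢ (j , x) ~ (j , d j ⊕ x) ⊎ Merged (j , x) × Merged (j , d j ⊕ x)
      step j x with j Fin.≟ i
      ... | no j≢i   = inj₁ (~⊕ j x (sym (agree j j≢i)))
      ... | yes refl with d i ≟ᴷ d′ i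
      ... | yes p≡q  = inj₁ (~⊕ i x (sym p≡q))
      ... | no  p≢q  = inj₂ (near x , near (d i ⊕ x))
        where
        near : ∀ y → Merged (i , y)
        near y with ⊕-exhaustive (d i) (d′ i) 𝟘 y (d≢𝟘 i) (d′≢𝟘 i) p≢q
        ... | inj₁ refl               = inj₁ ~refl
        ... | inj₂ (inj₁ refl)        = inj₁ (~sym (~translate _))
        ... | inj₂ (inj₂ (inj₁ refl)) = inj₂ ~refl
        ... | inj₂ (inj₂ (inj₂ refl)) = inj₂ (~sym (~translate _))

    module _ (apart : ¬ d ⊢ (i , 𝟘) ~ (i , d′ i ⊕ 𝟘)) where

      apart′ : ∀ x → ¬ d ⊢ (i , x) ~ (i , d′ i ⊕ x)
      apart′ x x~ = apart (~-shift d≢𝟘 (d′≢𝟘 i) x 𝟘 x~)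

      p≢q : d i ≢ d′ i
      p≢q p≡q = apart (~⊕ i 𝟘 p≡q)

      -- Otherwise the corners joined to (i , x) by curves of both d and d′ contain no other corner of
      -- the edge i; the arcs pair them up, while the translations pair up all of them but (i , x).
      reconnected : ∀ x → d′ ⊢ (i , x) ~ (i , d i ⊕ x)
      reconnected x with decide d′ (i , x) (i , d i ⊕ x)
      ... | yes x~px = x~px
      ... | no  x≁px = contradiction (∣1⇒≡1 (∣m+n∣m⇒∣n
              (subst (2 ∣_) (sym (ℕ.+-comm (length rest) 1)) block-even) rest-even)) λ ()
        where
        c : Corner e
        c = i , x

        Common : Corner e → Set
        Common z = d ⊢ c ~ z × d′ ⊢ c ~ z

        other? : ∀ z → Dec (Common z × z ≢ c)
        other? z = (decide d c z ×-dec decide d′ c z) ×-dec ¬? (z ≟ᶜ c)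

        rest : List (Corner e)
        rest = filter other? (corners e)

        rest⁺ : ∀ {z} → Common z → z ≢ c → z ∈ rest
        rest⁺ {z} common z≢c = ∈-filter⁺ other? (∈-corners z) (common , z≢c)

        rest⁻ : ∀ {z} → z ∈ rest → Common z × z ≢ c
        rest⁻ z∈ = proj₂ (∈-filter⁻ other? {xs = corners e} z∈)

        rest-unique : Unique rest
        rest-unique = Unique.filter⁺ other? (corners-unique e)

        block⁻ : ∀ {z} → z ∈ c ∷ rest → Common z
        block⁻ (here refl) = ~refl , ~refl
        block⁻ (there z∈)  = proj₁ (rest⁻ z∈)

        block-closed : ∀ {z} → z ∈ c ∷ rest → a z ∈ c ∷ rest
        block-closed {z} z∈ with s , t ← block⁻ z∈ | a z ≟ᶜ c
        ... | yes az≡c = here az≡c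
        ... | no  az≢c = there (rest⁺ (~trans s (~a z) , ~trans t (~a z)) az≢c)

        block-even : 2 ∣ suc (length rest)
        block-even = closed⇒even a-involutive a-no-fixed
          (All.tabulate (λ z∈ c≡z → proj₂ (rest⁻ z∈) (sym c≡z)) ∷ rest-unique) block-closed

        -- `d′ i ⊕ x` is apart from `x` in `d`, and `d i ⊕ x` is not joined to `x` in `d′`. A curve
        -- of `d` through `x` and the fourth corner would join that corner to `d i ⊕ x`, against
        -- `apart′`.
        rest-off-i : ∀ {j y} → (j , y) ∈ rest → j ≢ i
        rest-off-i {y = y} z∈ refl with (s , t) , y≢x ← rest⁻ z∈
                                   | ⊕-exhaustive (d i) (d′ i) x y (d≢𝟘 i) (d′≢𝟘 i) p≢q
        ... | inj₁ refl               = y≢x refl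
        ... | inj₂ (inj₁ refl)        = apart′ x s
        ... | inj₂ (inj₂ (inj₁ refl)) = x≁px t
        ... | inj₂ (inj₂ (inj₂ refl)) = apart′ (d i ⊕ x) (~trans (~sym (~translate c)) s)

        rest-closed : ∀ {z} → z ∈ rest → translate d z ∈ rest
        rest-closed {j , y} z∈ with (s , t) , _ ← rest⁻ z∈ =
          rest⁺ (~trans s (~translate _) , ~trans t (~⊕ j y (sym (agree j j≢i))))
                (j≢i ∘ cong proj₁)
          where
          j≢i = rest-off-i z∈

        rest-even : 2 ∣ length rest
        rest-even = closed⇒even (translate-involutive d) (translate-no-fixed d≢𝟘)
          rest-unique rest-closed

      -- `reconnected` makes each curve of `d` part of one of `d′`, and the corners at `𝟘` and
      -- `d′ i ⊕ 𝟘`, apart in `d`, are joined in `d′`.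
      curves-< : curves d′ ℕ.< curves d
      curves-< = orbits-strictly-antitone
        (⊢-mono {d} {d′} step) (sameOrbit {d = d′} (~translate (i , 𝟘))) (apart ∘ ⟨_⟩ {d = d})
        where
        step : ∀ c → d′ ⊢ c ~ translate d c
        step (j , x) with j Fin.≟ i
        ... | yes refl = reconnected x
        ... | no  j≢i  = ~⊕ j x (sym (agree j j≢i))

-- Words act linearly on each edge

act : Letter → Klein → Klein
act δ = swap
act τ = halfTwist

act-involutive : ∀ l x → act l (act l x) ≡ x
act-involutive δ x = refl
act-involutive τ x = halfTwist-involutive x

act-𝟘 : ∀ l → act l 𝟘 ≡ 𝟘
act-𝟘 δ = refl
act-𝟘 τ = refl

act-⊕ : ∀ l p x → act l (p ⊕ x) ≡ act l p ⊕ act l x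
act-⊕ δ p x = refl
act-⊕ τ = from-yes (∀Klein? λ p → ∀Klein? λ x → halfTwist (p ⊕ x) ≟ᴷ (halfTwist p ⊕ halfTwist x))

-- The corner c of G^{w|A} is the corner onEdges A (toOld w) c of G.
toOld toNew : Word → Klein → Klein
toOld []      = id
toOld (l ∷ w) = act l ∘ toOld w
toNew []      = id
toNew (l ∷ w) = toNew w ∘ act l

toNew-toOld : ∀ w x → toNew w (toOld w x) ≡ x
toNew-toOld []      x = refl
toNew-toOld (l ∷ w) x = trans (cong (toNew w) (act-involutive l (toOld w x))) (toNew-toOld w x)

toOld-toNew : ∀ w x → toOld w (toNew w x) ≡ x
toOld-toNew []      x = refl
toOld-toNew (l ∷ w) x = trans (cong (act l) (toOld-toNew w (act l x))) (act-involutive l x)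

toOld-⊕ : ∀ w p x → toOld w (p ⊕ x) ≡ toOld w p ⊕ toOld w x
toOld-⊕ []      p x = refl
toOld-⊕ (l ∷ w) p x = trans (cong (act l) (toOld-⊕ w p x)) (act-⊕ l (toOld w p) (toOld w x))

toNew-𝟘 : ∀ w → toNew w 𝟘 ≡ 𝟘
toNew-𝟘 []      = refl
toNew-𝟘 (l ∷ w) = trans (cong (toNew w) (act-𝟘 l)) (toNew-𝟘 w)

toOld-≢𝟘 : ∀ w {p} → p ≢ 𝟘 → toOld w p ≢ 𝟘
toOld-≢𝟘 w {p} p≢𝟘 eq = p≢𝟘 (trans (sym (toNew-toOld w p)) (trans (cong (toNew w) eq) (toNew-𝟘 w)))

onEdges-id : ∀ {e} (A : Subset e) c → onEdges A id c ≡ c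
onEdges-id A (i , x) with lookupᵛ A i
... | true  = refl
... | false = refl

onEdges-∘ : ∀ {e} (A : Subset e) g h c → onEdges A (g ∘ h) c ≡ onEdges A g (onEdges A h c)
onEdges-∘ A g h (i , x) with lookupᵛ A i
... | true  = refl
... | false = refl

onEdges-inverse : ∀ {e} (A : Subset e) g h → (∀ x → g (h x) ≡ x) →
                  ∀ c → onEdges A g (onEdges A h c) ≡ c
onEdges-inverse A g h gh (i , x) with lookupᵛ A i
... | true  = cong (i ,_) (gh x)
... | false = refl

-- Each letter conjugates `arc` by an involution on the edges of `A`. The composite need not be an
-- involution (it has order three for `δ ∷ τ ∷ []`), so the two sides use `toOld` and its inverse.
arc-word : ∀ {e} (G : RibbonGraph e) w A c →
           arc (G ^[ w ∣ A ]) c ≡ onEdges A (toNew w) (arc G (onEdges A (toOld w) c))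
arc-word G []      A c = sym (trans (onEdges-id A _) (cong (arc G) (onEdges-id A c)))
arc-word G (l ∷ w) A c = trans (arc-word (apply A G l) w A c)
  (trans (cong (onEdges A (toNew w)) (arc-letter l (onEdges A (toOld w) c)))
    (trans (cong (λ d → onEdges A (toNew w) (onEdges A (act l) (arc G d)))
             (sym (onEdges-∘ A (act l) (toOld w) c)))
      (sym (onEdges-∘ A (toNew w) (act l) _))))
  where
  arc-letter : ∀ l d → arc (apply A G l) d ≡ onEdges A (act l) (arc G (onEdges A (act l) d))
  arc-letter δ d = refl
  arc-letter τ d = refl

isolated-word : ∀ {e} (G : RibbonGraph e) w A → isolated (G ^[ w ∣ A ]) ≡ isolated G
isolated-word G []      A = refl
isolated-word G (δ ∷ w) A = isolated-word (apply A G δ) w A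
isolated-word G (τ ∷ w) A = isolated-word (apply A G τ) w A

-- Translation by `p` at every edge of the transformed graph, pulled back to the corners of `G`
-- along the additive map `toOld w`.
directions : ∀ {e} → Word → Klein → Subset e → Directions e
directions w p A i = if lookupᵛ A i then toOld w p else p

directions-nonzero : ∀ {e} w {p} → p ≢ 𝟘 → (A : Subset e) → Nonzero (directions w p A)
directions-nonzero w p≢𝟘 A i with lookupᵛ A i
... | true  = toOld-≢𝟘 w p≢𝟘
... | false = p≢𝟘

module _ {e} (w : Word) (p : Klein) (A : Subset e) {i : Fin e} where

  directions-∈ : i ∈ˢ A → directions w p A i ≡ toOld w p
  directions-∈ i∈A rewrite []=⇒lookup i∈A = refl

  directions-∉ : i ∉ˢ A → directions w p A i ≡ p
  directions-∉ i∉A with lookupᵛ A i in eq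
  ... | true  = contradiction (lookup⇒[]= i A eq) i∉A
  ... | false = refl

translate-toOld : ∀ {e} w p (A : Subset e) c →
                  onEdges A (toOld w) (translate (λ _ → p) c) ≡
                  translate (directions w p A) (onEdges A (toOld w) c)
translate-toOld w p A (i , x) with lookupᵛ A i
... | true  = cong (i ,_) (toOld-⊕ w p x)
... | false = refl

-- Euler genus after a word, in terms of curves on `G`

module Words {e} (G : RibbonGraph e) where

  open Curves (arc G) (arc-involutive G) (arc-no-fixed G)

  module _ (w : Word) (A : Subset e) where

    private
      old new : Corner e → Corner e
      old = onEdges A (toOld w)
      new = onEdges A (toNew w)

      old-new : ∀ c → old (new c) ≡ c
      old-new = onEdges-inverse A (toOld w) (toNew w) (toOld-toNew w)

      new-old : ∀ c → new (old c) ≡ c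
      new-old = onEdges-inverse A (toNew w) (toOld w) (toNew-toOld w)

      arc-old : ∀ c → arc G (old c) ≡ old (arc (G ^[ w ∣ A ]) c)
      arc-old c = trans (sym (old-new _)) (cong old (sym (arc-word G w A c)))

      arc-new : ∀ c → arc (G ^[ w ∣ A ]) (new c) ≡ new (arc G c)
      arc-new c = trans (arc-word G w A (new c)) (cong (new ∘ arc G) (old-new c))

    -- `old` and `new` are mutually inverse and intertwine both generators, so they match the orbits
    -- one to one.
    orbits-word : ∀ p → orbits (arc (G ^[ w ∣ A ]) ∷ translate (λ _ → p) ∷ []) ≡
                        curves (directions w p A)
    orbits-word p = ℕ.≤-antisym
      (orbits-≤-image new old new-old λ where
        (here refl)         → Eq.return (here (arc-new _))
        (there (here refl)) → Eq.return (there (here (sym (translate-new _)))))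
      (orbits-≤-image old new old-new λ where
        (here refl)         → Eq.return (here (arc-old _))
        (there (here refl)) → Eq.return (there (here (sym (translate-toOld w p A _)))))
      where
      translate-new : ∀ c → new (translate (directions w p A) c) ≡ translate (λ _ → p) (new c)
      translate-new c = trans (cong (new ∘ translate (directions w p A)) (sym (old-new c)))
        (trans (cong new (sym (translate-toOld w p A (new c)))) (new-old _))

    sameEdge : ∀ (H : RibbonGraph e) i x y → SameOrbit (arc H ∷ end ∷ side ∷ []) (i , x) (i , y)
    sameEdge H i x y = C.trans (toBase x) (C.sym (toBase y))
      where
      module C = IsEquivalence (orbitEquivalence (arc H ∷ end ∷ side ∷ []))

      toBase : ∀ x → SameOrbit (arc H ∷ end ∷ side ∷ []) (i , x) (i , 𝟘)
      toBase (false , false) = C.refl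
      toBase (false , true)  = Eq.return (there (here refl))
      toBase (true , false)  = Eq.return (there (there (here refl)))
      toBase (true , true)   = C.trans (Eq.return (there (here refl))) (toBase (true , false))

    -- `end` and `side` together connect the four corners of an edge, and relabelling preserves
    -- edges, so only the arcs have to be matched.
    components-word : components (G ^[ w ∣ A ]) ≡ components G
    components-word = cong₂ _+_ (isolated-word G w A) (ℕ.≤-antisym
      (orbits-≤-image new old new-old λ where
        (here refl)                 → Eq.return (here (arc-new _))
        (there (here refl))         → sameEdge (G ^[ w ∣ A ]) _ _ _
        (there (there (here refl))) → sameEdge (G ^[ w ∣ A ]) _ _ _)
      (orbits-≤-image old new old-new λ where
        (here refl)                 → Eq.return (here (arc-old _))
        (there (here refl))         → sameEdge G _ _ _
        (there (there (here refl))) → sameEdge G _ _ _))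

  vertexCurves faceCurves cost : Word → Subset e → ℕ
  vertexCurves w A = curves (directions w (false , true) A)
  faceCurves   w A = curves (directions w (true , false) A)
  cost         w A = vertexCurves w A + faceCurves w A

  -- The word changes neither the isolated vertices nor the number of components. Isolated vertices
  -- are counted once as vertices and once as boundary components.
  ε-word : ∀ w A → ε (G ^[ w ∣ A ]) ≡
           (+ 2 *ᶻ + components G +ᶻ + e) - + ((isolated G + isolated G) + cost w A)
  ε-word w A = trans (collect (+ 2 *ᶻ + components H) (+ vertices H) (+ e) (+ boundaryComponents H))
    (cong₂ (λ k n → (+ 2 *ᶻ + k +ᶻ + e) - + n) (components-word w A)
      (trans (cong₂ _+_ (cong₂ _+_ (isolated-word G w A) (orbits-word w A (false , true)))
                        (cong₂ _+_ (isolated-word G w A) (orbits-word w A (true , false))))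
             (interchange ℕ.+-commutativeSemigroup
               (isolated G) (vertexCurves w A) (isolated G) (faceCurves w A))))
    where
    H = G ^[ w ∣ A ]

    open +-*-Solver using (_:+_; _:-_; _:=_)

    collect : ∀ k v m f → k - v +ᶻ m - f ≡ (k +ᶻ m) - (v +ᶻ f)
    collect = +-*-Solver.solve 4 (λ k v m f → ((k :- v) :+ m) :- f := (k :+ m) :- (v :+ f)) refl

  -- The constant in `ε-word` depends on `G` alone. Comparing different words lets `ε G` enter as
  -- the empty word.
  ε-antitone : ∀ w A w′ B → cost w A ℕ.≤ cost w′ B → ε (G ^[ w′ ∣ B ]) ≤ ε (G ^[ w ∣ A ])
  ε-antitone w A w′ B le = subst₂ _≤_ (sym (ε-word w′ B)) (sym (ε-word w A))
    (ℤ.+-monoʳ-≤ (+ 2 *ᶻ + components G +ᶻ + e)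
      (ℤ.neg-mono-≤ (+≤+ (ℕ.+-monoʳ-≤ (isolated G + isolated G) le))))

  -- Effect on the curves of adding one edge

  module _ (w : Word) {p : Klein} (p≢𝟘 : p ≢ 𝟘) where

    private
      along : Subset e → Directions e
      along = directions w p

      switched : ∀ S i j → j ≢ i → along S j ≡ along (S ∪ ⁅ i ⁆) j
      switched S i j j≢i with j ∈? S
      ... | yes j∈S = trans (directions-∈ w p S j∈S)
                            (sym (directions-∈ w p (S ∪ ⁅ i ⁆) (x∈p∪q⁺ (inj₁ j∈S))))
      ... | no  j∉S = trans (directions-∉ w p S j∉S)
                            (sym (directions-∉ w p (S ∪ ⁅ i ⁆)
                              ([ j∉S , j≢i ∘ x∈⁅y⁆⇒x≡y i ]′ ∘ x∈p∪q⁻ S ⁅ i ⁆)))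

      module At S i = Switch (directions-nonzero w p≢𝟘 S) (directions-nonzero w p≢𝟘 (S ∪ ⁅ i ⁆))
                             (switched S i)

    curves-rise : ∀ S i → curves (along (S ∪ ⁅ i ⁆)) ℕ.≤ suc (curves (along S))
    curves-rise S i = At.curves-≤-suc S i

    -- Where `i` is in both sets or in neither, their directions agree, which contradicts `apart`.
    -- Otherwise adding `i` to `S` gives it the direction of `A`, and `curves-<` applies.
    apart⇒drop : ∀ {S A} → S ⊆ A → ∀ i → ¬ along S ⊢ (i , 𝟘) ~ (i , along A i ⊕ 𝟘) →
                 i ∈ˢ A × i ∉ˢ S × curves (along (S ∪ ⁅ i ⁆)) ℕ.< curves (along S)
    apart⇒drop {S} {A} S⊆A i apart with i ∈? A | i ∈? S
    ... | _       | yes i∈S = contradiction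
      (~⊕ i 𝟘 (trans (directions-∈ w p S i∈S) (sym (directions-∈ w p A (S⊆A i∈S))))) apart
    ... | no i∉A  | no i∉S  = contradiction
      (~⊕ i 𝟘 (trans (directions-∉ w p S i∉S) (sym (directions-∉ w p A i∉A)))) apart
    ... | yes i∈A | no i∉S  = i∈A , i∉S , At.curves-< S i
      (subst (λ q → ¬ along S ⊢ (i , 𝟘) ~ (i , q ⊕ 𝟘))
        (trans (directions-∈ w p A i∈A)
               (sym (directions-∈ w p (S ∪ ⁅ i ⁆) (x∈p∪q⁺ (inj₂ (x∈⁅x⁆ i)))))) apart)

    -- If `S` joined the corners along the direction of `A` at every edge, `curves-≤` would
    -- contradict the hypothesis. Joining is decidable and the edges are finite in number, so a
    -- failing edge is found.
    curves-drop : ∀ {S A} → S ⊆ A → curves (along A) ℕ.< curves (along S) →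
                  ∃ λ i → i ∈ˢ A × i ∉ˢ S × curves (along (S ∪ ⁅ i ⁆)) ℕ.< curves (along S)
    curves-drop {S} {A} S⊆A A<S = Product.map₂ (λ {i} → apart⇒drop S⊆A i)
      (Fin.¬∀⟶∃¬ e _ (λ i → decide (along S) (i , 𝟘) (i , along A i ⊕ 𝟘))
        (λ joined → ℕ.<⇒≱ A<S
          (curves-≤ (directions-nonzero w p≢𝟘 S) (directions-nonzero w p≢𝟘 A) joined)))

    curves-⊥ : ∀ w′ → curves (along ⊥) ℕ.≤ curves (directions w′ p ⊥)
    curves-⊥ w′ = curves-≤ (directions-nonzero w p≢𝟘 ⊥) (directions-nonzero w′ p≢𝟘 ⊥) λ i →
      ~⊕ i 𝟘 (trans (directions-∉ w p ⊥ {i} ∉⊥) (sym (directions-∉ w′ p ⊥ {i} ∉⊥)))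

  -- On the empty edge set no word changes a direction, and `G` is the result of the empty word.
  εG≤ε-word⊥ : ∀ w → ε G ≤ ε (G ^[ w ∣ ⊥ ])
  εG≤ε-word⊥ w = ε-antitone w ⊥ [] ⊥ (ℕ.+-mono-≤ (curves-⊥ w (λ ()) []) (curves-⊥ w (λ ()) []))

-- Descent

module Descent {e} (f g : Subset e → ℕ) where

  -- `Drops` picks its edge from `A` itself, so a descent directed at `A` stays inside it.
  Rises Drops : (Subset e → ℕ) → Set
  Rises h = ∀ S i → h (S ∪ ⁅ i ⁆) ℕ.≤ suc (h S)
  Drops h = ∀ {S A} → S ⊆ A → h A ℕ.< h S → ∃ λ i → i ∈ˢ A × i ∉ˢ S × h (S ∪ ⁅ i ⁆) ℕ.< h S

  total : Subset e → ℕ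
  total S = f S + g S

  _≽_ : Rel (Subset e) 0ℓ
  S ≽ T = total T ℕ.≤ total S

  prefixes : Subset e → List (Fin e) → List (Subset e)
  prefixes S es = map (λ ds → S ∪ fromList ds) (inits es)

  -- The path aims at `A` but may stop early, at any set whose `total` is no larger than that of
  -- `A`.
  record Path (S A : Subset e) : Set where
    field
      order      : List (Fin e)
      unique     : Unique order
      fresh      : All (_∉ˢ S) order
      descending : Linked _≽_ (prefixes S order)
      optimal    : A ≽ (S ∪ fromList order)

  open Path

  stay : ∀ {S A} → f S ℕ.≤ f A → g S ℕ.≤ g A → Path S A
  stay {S} {A} f≤ g≤ = record
    { order      = []
    ; unique     = []
    ; fresh      = []
    ; descending = [-]
    ; optimal    = subst (A ≽_) (sym (∪-identityʳ S)) (ℕ.+-mono-≤ f≤ g≤)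
    }

  prefixes-∷ : ∀ S i es → prefixes S (i ∷ es) ≡ (S ∪ ⊥) ∷ prefixes (S ∪ ⁅ i ⁆) es
  prefixes-∷ S i es = cong ((S ∪ ⊥) ∷_)
    (trans (sym (map-∘ (inits es)))
           (map-cong (λ ds → sym (∪-assoc S ⁅ i ⁆ (fromList ds))) (inits es)))

  extend : ∀ {S A i} → i ∉ˢ S → S ≽ (S ∪ ⁅ i ⁆) → Path (S ∪ ⁅ i ⁆) A → Path S A
  extend {S} {A} {i} i∉S S≽ P = record
    { order      = i ∷ order P
    ; unique     = All.map (λ j∉ → λ { refl → j∉ (x∈p∪q⁺ (inj₂ (x∈⁅x⁆ i))) }) (fresh P) ∷ unique P
    ; fresh      = i∉S ∷ All.map (λ j∉ j∈S → j∉ (x∈p∪q⁺ (inj₁ j∈S))) (fresh P)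
    ; descending = subst (Linked _≽_) (sym (prefixes-∷ S i (order P)))
                     -- The prefix lists are headed by `S ∪ ⊥` and `(S ∪ ⁅ i ⁆) ∪ ⊥`, so the first
                     -- comparison is restated for these.
                     (subst₂ _≽_ (sym (∪-identityʳ S)) (sym (∪-identityʳ (S ∪ ⁅ i ⁆))) S≽ ∷ descending P)
    ; optimal    = subst (A ≽_) (∪-assoc S ⁅ i ⁆ (fromList (order P))) (optimal P)
    }

  module _ (f-rises : Rises f) (g-rises : Rises g) (f-drops : Drops f) (g-drops : Drops g) where

    -- A strict drop of one summand pays for the rise of the other by at most one.
    f-step : ∀ {S i} → f (S ∪ ⁅ i ⁆) ℕ.< f S → S ≽ (S ∪ ⁅ i ⁆)
    f-step {S} {i} f< = ℕ.≤-trans (ℕ.+-monoʳ-≤ (f (S ∪ ⁅ i ⁆)) (g-rises S i))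
      (subst (ℕ._≤ total S) (sym (ℕ.+-suc (f (S ∪ ⁅ i ⁆)) (g S))) (ℕ.+-monoˡ-≤ (g S) f<))

    g-step : ∀ {S i} → g (S ∪ ⁅ i ⁆) ℕ.< g S → S ≽ (S ∪ ⁅ i ⁆)
    g-step {S} {i} g< = ℕ.≤-trans (ℕ.+-monoˡ-≤ (g (S ∪ ⁅ i ⁆)) (f-rises S i))
      (subst (ℕ._≤ total S) (ℕ.+-suc (f S) (g (S ∪ ⁅ i ⁆))) (ℕ.+-monoʳ-≤ (f S) g<))

    -- The set grows inside `A` until neither `f` nor `g` exceeds its value at `A`; strict growth
    -- among subsets of a finite set ends the recursion.
    path : ∀ {S A} → S ⊆ A → Path S A
    path {S} {A} = go S (⊃-wellFounded S)
      where
      go : ∀ S → Acc _⊃_ S → S ⊆ A → Path S A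

      advance : ∀ S → Acc _⊃_ S → S ⊆ A → ∀ {i} → i ∈ˢ A → i ∉ˢ S → S ≽ (S ∪ ⁅ i ⁆) → Path S A
      advance S (acc rec) S⊆A {i} i∈A i∉S S≽ = extend i∉S S≽ (go (S ∪ ⁅ i ⁆)
        (rec (p⊆p∪q ⁅ i ⁆ , i , x∈p∪q⁺ (inj₂ (x∈⁅x⁆ i)) , i∉S))
        ([ S⊆A , (λ j∈ → subst (_∈ˢ A) (sym (x∈⁅y⁆⇒x≡y i j∈)) i∈A) ]′ ∘ x∈p∪q⁻ S ⁅ i ⁆))

      go S S-acc S⊆A with f A ℕ.<? f S | g A ℕ.<? g S
      ... | no f≮   | no g≮  = stay (ℕ.≮⇒≥ f≮) (ℕ.≮⇒≥ g≮)
      ... | yes f<  | _      = let i , i∈A , i∉S , drop = f-drops S⊆A f<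
                               in advance S S-acc S⊆A i∈A i∉S (f-step drop)
      ... | no _    | yes g< = let i , i∈A , i∉S , drop = g-drops S⊆A g<
                               in advance S S-acc S⊆A i∈A i∉S (g-step drop)

-- The maximum over all edge sets is attained

∈-subsets : ∀ {e} (A : Subset e) → A ∈ subsets e
∈-subsets []          = here refl
∈-subsets {suc e} (true  ∷ A) = ∈-++⁺ˡ (∈-map⁺ (true ∷_) (∈-subsets A))
∈-subsets {suc e} (false ∷ A) = ∈-++⁺ʳ (map (true ∷_) (subsets e)) (∈-map⁺ (false ∷_) (∈-subsets A))

module _ {e} (w : Word) (G : RibbonGraph e) where

  private
    value : Subset e → ℤ
    value B = ε (G ^[ w ∣ B ])

  ε≤εᴹ : ∀ A → value A ≤ εᴹ w G
  ε≤εᴹ A = All.lookup (xs≤max (value ⊥) (map value (subsets e))) (∈-map⁺ value (∈-subsets A))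

  maximiser : ∃ λ A → value A ≡ εᴹ w G
  maximiser =
    -- The default value of `max` is the value at `⊥`, so a subset is found in that case too.
    [ (λ eq → ⊥ , sym eq) , (λ ∈values → Product.map₂ (sym ∘ proj₂) (∈-map⁻ value ∈values)) ]′
    (argmax-sel id (value ⊥) (map value (subsets e)))

lower-head : ∀ {x y zs} → x ≤ y → Linked _≤_ (y ∷ zs) → Linked _≤_ (x ∷ zs)
lower-head x≤y [-]         = [-]
lower-head x≤y (y≤z ∷ zs) = ℤ.≤-trans x≤y y≤z ∷ zs

corollary5p1 : ∀ {e : ℕ} (G : RibbonGraph e) (ρ : Word) →
    ρ ∈ (δ ∷ τ ∷ []) ∷ (τ ∷ δ ∷ []) ∷ (τ ∷ []) ∷ (δ ∷ τ ∷ δ ∷ []) ∷ [] →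
    Σ (Subset e) λ A → Σ (List (Fin e)) λ es →
    Unique es × fromList es ≡ A ×
    ε (G ^[ ρ ∣ A ]) ≡ εᴹ ρ G ×
    Linked _≤_ (ε G ∷ map (λ ds → ε (G ^[ ρ ∣ fromList ds ])) (drop 1 (inits es)))
corollary5p1 {e} G ρ _ =
  -- The witness is the endpoint of the path from `⊥` towards the maximiser `A` below, which need
  -- not be `A` itself.
  fromList order , order , unique , refl ,
  ℤ.≤-antisym (ε≤εᴹ ρ G (fromList order))
    (subst (_≤ value (fromList order)) (proj₂ (maximiser ρ G))
      (ε-antitone ρ (fromList order) ρ A (subst (A ≽_) (∪-identityˡ (fromList order)) optimal))) ,
  -- `inits order` begins with the empty list, so the chain from the descent is headed by the value
  -- at `⊥`; `lower-head` puts `ε G` in its place.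
  lower-head (εG≤ε-word⊥ ρ) (Linked.map⁺ {f = value ∘ fromList} {xs = inits order}
    (Linked.map (λ {ds} {es} S≽T → ε-antitone ρ (fromList es) ρ (fromList ds)
                  (subst₂ _≽_ (∪-identityˡ (fromList ds)) (∪-identityˡ (fromList es)) S≽T))
                (Linked.map⁻ descending)))
  where
  open Words G
  open Descent (vertexCurves ρ) (faceCurves ρ)

  value : Subset e → ℤ
  value B = ε (G ^[ ρ ∣ B ])

  A = proj₁ (maximiser ρ G)

  v≢𝟘 : (false , true) ≢ 𝟘
  v≢𝟘 ()

  f≢𝟘 : (true , false) ≢ 𝟘
  f≢𝟘 ()

  open Path (path (curves-rise ρ v≢𝟘) (curves-rise ρ f≢𝟘) (curves-drop ρ v≢𝟘) (curves-drop ρ f≢𝟘)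
                  (⊆-min A))
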